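{- Let $n \ge 10^9$ be an odd integer, let $k$ be an even integer with $\frac{2n}{5} < k < \frac{n}{2}$, and let $G$ be an $n$-vertex $k$-regular graph. If the number of triangles in $G$ is at most $\frac{k}{4}(3k-n-1)$, then $G$ can be made bipartite by deleting at most $\frac{15}{2}k^{3/2}$ edges. -}

module Defs where

open import Data.Nat using (ℕ; zero; suc; _+_; _*_; _<ᵇ_)
open import Data.Bool using (Bool; true; false; if_then_else_; _∧_)
open import Data.Fin using (Fin; toℕ) renaming (zero to fz; suc to fs)
open import Data.Product using (Σ; _×_)
open import Relation.Binary.PropositionalEquality using (_≡_; _≢_)

record SimpleGraph (n : ℕ) : Set where
  field
    adj   : Fin n → Fin n → Bool
    sym   : ∀ i j → adj i j ≡ adj j i
    loopless : ∀ i → adj i i ≡ false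
open SimpleGraph public

sumFin : (n : ℕ) → (Fin n → ℕ) → ℕ
sumFin zero    f = 0
sumFin (suc n) f = f fz + sumFin n (λ i → f (fs i))

countFin : (n : ℕ) → (Fin n → Bool) → ℕ
countFin n P = sumFin n (λ i → if P i then 1 else 0)

_<ꟳ_ : ∀ {n} → Fin n → Fin n → Bool
i <ꟳ j = toℕ i <ᵇ toℕ j

degree : ∀ {n} → SimpleGraph n → Fin n → ℕ
degree {n} G i = countFin n (λ j → adj G i j)

IsRegular : ∀ {n} → SimpleGraph n → ℕ → Set
IsRegular {n} G k = ∀ i → degree G i ≡ k

edgeCount : ∀ {n} → SimpleGraph n → ℕ
edgeCount {n} G = sumFin n (λ i → countFin n (λ j → (i <ꟳ j) ∧ adj G i j))

triangleCount : ∀ {n} → SimpleGraph n → ℕ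
triangleCount {n} G =
  sumFin n (λ i → sumFin n (λ j → countFin n (λ l →
    (i <ꟳ j) ∧ (j <ꟳ l) ∧ adj G i j ∧ adj G j l ∧ adj G i l)))

_⊆ᴳ_ : ∀ {n} → SimpleGraph n → SimpleGraph n → Set
_⊆ᴳ_ {n} H G = ∀ (i j : Fin n) → adj H i j ≡ true → adj G i j ≡ true

IsBipartite : ∀ {n} → SimpleGraph n → Set
IsBipartite {n} H = Σ (Fin n → Bool) (λ c → ∀ i j → adj H i j ≡ true → c i ≢ c j)

{-# OPTIONS --safe #-}

-- Write c(x,y) for the codegree, h = 3k − n and t(x) for the sum of c(x,y) over the neighbours y of x, so that
-- Σ t = 6T ≤ 3kh/2.  Counting the neighbours of each vertex among three, respectively five, given vertices gives
--   c(x,y) + c(y,z) + c(x,z) ≥ h   and   c(x₀,x₁) + c(x₁,x₂) + c(x₂,x₃) + c(x₃,x₄) + c(x₄,x₀) ≥ 5k − 2n ≥ 2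
-- for all vertices, adjacent or not; the last inequality uses that k is even.  Let m ≈ h/200.  All but boundedly many
-- vertices are good, meaning 8t ≤ mh, and for good x, y either c(x,y) ≤ m ("light") or 2c(x,y) > h.
-- No three vertices are pairwise light, by the first inequality.  Nor is there a closed 5-walk z₀ … z₄ of light pairs
-- of good vertices: the graph would be close to a blow-up of C₅ with parts Wᵢ of size about h, and averaging the
-- second inequality over W₀ × … × W₄ would force 3T close to 2h² or more, whereas 3T ≤ 3kh/4 ≤ 3h²/2.
-- Hence for a good vertex u, colouring x by whether the pair (u,x) is light leaves no monochromatic light pair of good
-- vertices, and only O(k) edges of the graph are not light or have a bad end.
module Submission where

open import Defs
open import Data.Bool using (Bool; true; false; if_then_else_; not; _∧_; _∨_; _xor_; T)
open import Data.Bool.Properties using (T-≡; T-∧; xor-comm; xor-same; ∧-zeroʳ; ∨-zeroʳ)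
open import Data.Empty using (⊥; ⊥-elim)
open import Data.Fin using (Fin; toℕ) renaming (zero to fz; suc to fs)
open import Data.Fin.Properties using (any?; toℕ-injective)
open import Data.Nat
open import Data.Nat.Properties
open import Data.Nat.Divisibility using (_∣_; divides)
open import Data.Nat.DivMod using (m/n*n≤m; m≡m%n+[m/n]*n; m%n<n)
open import Data.Nat.Tactic.RingSolver using (solve-∀)
open import Data.Product using (Σ; _×_; _,_; proj₁; proj₂; ∃-syntax)
open import Data.Sum using (_⊎_; inj₁; inj₂; [_,_]′)
open import Data.Unit using (tt)
open import Function using (Equivalence)
open import Relation.Binary.Definitions using (tri<; tri≈; tri>)
open import Relation.Binary.PropositionalEquality as ≡ using (_≡_; refl; cong; cong₂; trans; subst)
open import Relation.Nullary using (¬_; yes; no)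

∑ : ∀ {n} → (Fin n → ℕ) → ℕ
∑ {n} = sumFin n

⟦_⟧ : Bool → ℕ
⟦ b ⟧ = if b then 1 else 0

-- Finite sums

∑-cong : ∀ {n} {f g : Fin n → ℕ} → (∀ i → f i ≡ g i) → ∑ f ≡ ∑ g
∑-cong {zero}  p = refl
∑-cong {suc n} p = cong₂ _+_ (p fz) (∑-cong (λ i → p (fs i)))

∑-mono : ∀ {n} {f g : Fin n → ℕ} → (∀ i → f i ≤ g i) → ∑ f ≤ ∑ g
∑-mono {zero}  p = z≤n
∑-mono {suc n} p = +-mono-≤ (p fz) (∑-mono (λ i → p (fs i)))

∑-zero : ∀ n → ∑ {n} (λ _ → 0) ≡ 0
∑-zero zero    = refl
∑-zero (suc n) = ∑-zero n

+-interchange : ∀ a b c d → (a + b) + (c + d) ≡ (a + c) + (b + d)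
+-interchange = solve-∀

∑-+ : ∀ {n} (f g : Fin n → ℕ) → ∑ f + ∑ g ≡ ∑ (λ i → f i + g i)
∑-+ {zero}  f g = refl
∑-+ {suc n} f g = trans (+-interchange (f fz) _ (g fz) _)
  (cong (f fz + g fz +_) (∑-+ (λ i → f (fs i)) (λ i → g (fs i))))

∑-* : ∀ {n} c (f : Fin n → ℕ) → c * ∑ f ≡ ∑ (λ i → c * f i)
∑-* {zero}  c f = *-zeroʳ c
∑-* {suc n} c f = trans (*-distribˡ-+ c (f fz) _) (cong (c * f fz +_) (∑-* c (λ i → f (fs i))))

∑-swap : ∀ {n m} (f : Fin n → Fin m → ℕ) → ∑ (λ i → ∑ (f i)) ≡ ∑ (λ j → ∑ (λ i → f i j))
∑-swap {zero}  {m} f = ≡.sym (∑-zero m)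
∑-swap {suc n} f = trans (cong (∑ (f fz) +_) (∑-swap (λ i → f (fs i)))) (∑-+ (f fz) _)

∑-one : ∀ n → n ≡ ∑ {n} (λ _ → 1)
∑-one zero    = refl
∑-one (suc n) = cong suc (∑-one n)

-- Presentations of numbers as sums over Fin n, built along the shape of an expression.

infixl 6 _⊕_
infixr 7 _⊛_

record IsSum {n} (a : ℕ) (f : Fin n → ℕ) : Set where
  constructor is-sum
  field equality : a ≡ ∑ f

∑! : ∀ {n} {f : Fin n → ℕ} → IsSum (∑ f) f
∑! = is-sum refl

_⊕_ : ∀ {n a b} {f g : Fin n → ℕ} → IsSum a f → IsSum b g → IsSum (a + b) (λ i → f i + g i)
_⊕_ {f = f} {g} (is-sum p) (is-sum q) = is-sum (trans (cong₂ _+_ p q) (∑-+ f g))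

_⊛_ : ∀ {n a} {f : Fin n → ℕ} c → IsSum a f → IsSum (c * a) (λ i → c * f i)
_⊛_ {f = f} c (is-sum p) = is-sum (trans (cong (c *_) p) (∑-* c f))

∑1 : ∀ {n} → IsSum {n} n (λ _ → 1)
∑1 {n} = is-sum (∑-one n)

∑-≤ : ∀ {n a b} {f g : Fin n → ℕ} → IsSum a f → IsSum b g → (∀ i → f i ≤ g i) → a ≤ b
∑-≤ (is-sum p) (is-sum q) r = ≤-trans (≤-reflexive p) (≤-trans (∑-mono r) (≤-reflexive (≡.sym q)))

∑-≡ : ∀ {n a b} {f g : Fin n → ℕ} → IsSum a f → IsSum b g → (∀ i → f i ≡ g i) → a ≡ b
∑-≡ (is-sum p) (is-sum q) r = trans p (trans (∑-cong r) (≡.sym q))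

-- Inequalities between expressions in 0/1-valued quantities, by truth tables.

BitFun : ℕ → Set
BitFun zero    = ℕ
BitFun (suc r) = Bool → BitFun r

_≦_ : ∀ {r} → BitFun r → BitFun r → Set
_≦_ {zero}  a b = a ≤ b
_≦_ {suc r} f g = ∀ b → f b ≦ g b

table : ∀ r → BitFun r → BitFun r → Bool
table zero    a b = a ≤ᵇ b
table (suc r) f g = table r (f true) (g true) ∧ table r (f false) (g false)

by-table : ∀ r (f g : BitFun r) → T (table r f g) → f ≦ g
by-table zero    a b p = ≤ᵇ⇒≤ a b p
by-table (suc r) f g p true  = by-table r _ _ (proj₁ (Equivalence.to T-∧ p))
by-table (suc r) f g p false = by-table r _ _ (proj₂ (Equivalence.to (T-∧ {table r (f true) (g true)}) p))

-- Codegrees in a regular graph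

module Codegree {n k : ℕ} (G : SimpleGraph n) (reg : IsRegular G k) where

  deg : ∀ x → IsSum k (λ y → ⟦ adj G x y ⟧)
  deg x = is-sum (≡.sym (reg x))

  c : Fin n → Fin n → ℕ
  c x y = ∑ (λ z → ⟦ adj G x z ⟧ * ⟦ adj G y z ⟧)

  -- A vertex adjacent to s of the three is counted s times on the left and 1 + s(s - 1)/2 times on
  -- the right.
  triple : ∀ x y z → k + k + k ≤ n + (c x y + c y z + c x z)
  triple x y z = ∑-≤ (deg x ⊕ deg y ⊕ deg z) (∑1 ⊕ (∑! ⊕ ∑! ⊕ ∑!)) λ i →
    by-table 3 (λ a b d → ⟦ a ⟧ + ⟦ b ⟧ + ⟦ d ⟧)
               (λ a b d → 1 + (⟦ a ⟧ * ⟦ b ⟧ + ⟦ b ⟧ * ⟦ d ⟧ + ⟦ a ⟧ * ⟦ d ⟧)) tt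
               (adj G x i) (adj G y i) (adj G z i)

-- Triangles as closed walks of length 3

∑³ : ∀ {n} → (Fin n → Fin n → Fin n → ℕ) → ℕ
∑³ f = ∑ (λ i → ∑ (λ j → ∑ (f i j)))

∑³-swap₁₂ : ∀ {n} (f : Fin n → Fin n → Fin n → ℕ) → ∑³ (λ i j l → f j i l) ≡ ∑³ f
∑³-swap₁₂ f = ∑-swap (λ i j → ∑ (f j i))

∑³-swap₂₃ : ∀ {n} (f : Fin n → Fin n → Fin n → ℕ) → ∑³ (λ i j l → f i l j) ≡ ∑³ f
∑³-swap₂₃ f = ∑-cong (λ i → ∑-swap (λ j l → f i l j))

∑³-+ : ∀ {n} (f g : Fin n → Fin n → Fin n → ℕ) → ∑³ (λ i j l → f i j l + g i j l) ≡ ∑³ f + ∑³ g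
∑³-+ {n} f g = ≡.sym (trans (∑-+ {n} _ _) (∑-cong λ i → trans (∑-+ {n} _ _) (∑-cong λ j → ∑-+ (f i j) (g i j))))

∑³-permutations : ∀ {n} (f : Fin n → Fin n → Fin n → ℕ) →
  ∑³ (λ i j l → f i j l + f i l j + (f j i l + f j l i) + (f l i j + f l j i)) ≡ 6 * ∑³ f
∑³-permutations {n} f = trans (∑³-+ {n} _ _) (trans (cong₂ _+_ (trans (∑³-+ {n} _ _) (cong₂ _+_ (∑³-+ {n} _ _) (∑³-+ {n} _ _))) (∑³-+ {n} _ _))
  (trans (cong₂ _+_ (cong₂ _+_ (cong (∑³ f +_) p₁₃₂) (cong₂ _+_ p₂₁₃ p₂₃₁)) (cong₂ _+_ p₃₁₂ p₃₂₁)) (six (∑³ f))))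
  where
  p₁₃₂ = ∑³-swap₂₃ f
  p₂₁₃ = ∑³-swap₁₂ f
  p₂₃₁ = trans (∑³-swap₁₂ (λ i j l → f i l j)) p₁₃₂
  p₃₁₂ = trans (∑³-swap₂₃ (λ i j l → f j i l)) p₂₁₃
  p₃₂₁ = trans (∑³-swap₂₃ (λ i j l → f j l i)) p₂₃₁
  six : ∀ a → a + a + (a + a) + (a + a) ≡ 6 * a
  six = solve-∀

adj⇒comparable : ∀ {n} (G : SimpleGraph n) i j → adj G i j ≡ true → (i <ꟳ j) ∨ (j <ꟳ i) ≡ true
adj⇒comparable G i j p with <-cmp (toℕ i) (toℕ j)
... | tri< i<j _ _ = cong (_∨ (j <ꟳ i)) (Equivalence.to T-≡ (<⇒<ᵇ i<j))
... | tri≈ _ i≡j _ with refl ← toℕ-injective i≡j with () ← trans (≡.sym p) (loopless G i)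
... | tri> _ _ j<i = trans (cong ((i <ꟳ j) ∨_) (Equivalence.to T-≡ (<⇒<ᵇ j<i))) (∨-zeroʳ _)

-- Without loops, any two of three mutually adjacent vertices are comparable, so one of the six
-- orderings is increasing.
six-orders : ∀ {n} (G : SimpleGraph n) →
  let O = λ i j l → ⟦ (i <ꟳ j) ∧ (j <ꟳ l) ∧ adj G i j ∧ adj G j l ∧ adj G i l ⟧ in
  ∀ i j l → ⟦ adj G i j ⟧ * (⟦ adj G i l ⟧ * ⟦ adj G j l ⟧) ≤ O i j l + O i l j + (O j i l + O j l i) + (O l i j + O l j i)
six-orders G i j l rewrite sym G j i | sym G l i | sym G l j
  with adj G i j in p | adj G i l in q | adj G j l in r
... | false | _ | _ = z≤n
... | true | false | _ = z≤n
... | true | true | false = z≤n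
... | true | true | true = ≤-trans (≤-reflexive (cong ⟦_⟧ (≡.sym
  (cong₂ _∧_ (adj⇒comparable G i j p) (cong₂ _∧_ (adj⇒comparable G i l q) (adj⇒comparable G j l r))))))
  -- However the three pairs are oriented, some ordering of the vertices follows a directed path, so
  -- the six comparisons can be tabulated as free bits.
  (by-table 6 (λ ij ji il li jl lj → ⟦ (ij ∨ ji) ∧ (il ∨ li) ∧ (jl ∨ lj) ⟧)
    (λ ij ji il li jl lj → ⟦ ij ∧ jl ∧ true ⟧ + ⟦ il ∧ lj ∧ true ⟧ + (⟦ ji ∧ il ∧ true ⟧ + ⟦ jl ∧ li ∧ true ⟧)
      + (⟦ li ∧ ij ∧ true ⟧ + ⟦ lj ∧ ji ∧ true ⟧)) tt
    (i <ꟳ j) (j <ꟳ i) (i <ꟳ l) (l <ꟳ i) (j <ꟳ l) (l <ꟳ j))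

module Triangles {n k : ℕ} (G : SimpleGraph n) (reg : IsRegular G k) where
  open Codegree G reg

  t : Fin n → ℕ
  t x = ∑ (λ y → ⟦ adj G x y ⟧ * c x y)

  ∑t≤6triangles : ∑ t ≤ 6 * triangleCount G
  ∑t≤6triangles = begin
    ∑ t ≡⟨ ∑-cong (λ x → ∑-cong λ y → ∑-* {n} ⟦ adj G x y ⟧ _) ⟩
    ∑³ (λ x y z → ⟦ adj G x y ⟧ * (⟦ adj G x z ⟧ * ⟦ adj G y z ⟧)) ≤⟨ ∑-mono (λ x → ∑-mono λ y → ∑-mono (six-orders G x y)) ⟩
    _ ≡⟨ ∑³-permutations {n} _ ⟩
    6 * triangleCount G ∎
    where open ≤-Reasoning

-- Averages over weighted 5-tuples

pairSum : ∀ {n} (v w : Fin n → ℕ) (D : Fin n → Fin n → ℕ) → ℕ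
pairSum v w D = ∑ (λ x → v x * ∑ (λ y → w y * D x y))

pairSum-swap : ∀ {n} (v w : Fin n → ℕ) D → ∑ (λ y → w y * ∑ (λ x → v x * D x y)) ≡ pairSum v w D
pairSum-swap {n} v w D = begin
  ∑ (λ y → w y * ∑ (λ x → v x * D x y)) ≡⟨ ∑-cong (λ y → ∑-* {n} (w y) _) ⟩
  ∑ (λ y → ∑ (λ x → w y * (v x * D x y))) ≡⟨ ∑-swap {n} {n} _ ⟩
  ∑ (λ x → ∑ (λ y → w y * (v x * D x y))) ≡⟨ ∑-cong (λ x → ∑-cong λ y → rearrange (w y) (v x) (D x y)) ⟩
  ∑ (λ x → ∑ (λ y → v x * (w y * D x y))) ≡⟨ ∑-cong (λ x → ∑-* {n} (v x) _) ⟨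
  pairSum v w D ∎
  where
  open ≡.≡-Reasoning
  rearrange : ∀ a b d → a * (b * d) ≡ b * (a * d)
  rearrange = solve-∀

-- One averaging step: the inequality at x is multiplied by the weight of x and summed. The
-- coefficients p and q collect the total weights of the variables already summed.
average : ∀ {n} (w f g : Fin n → ℕ) a b p q → (∀ x → a ≤ b + p * f x + q * g x) →
  a * ∑ w ≤ b * ∑ w + p * ∑ (λ x → w x * f x) + q * ∑ (λ x → w x * g x)
average w f g a b p q le = ∑-≤ (a ⊛ ∑!) (b ⊛ ∑! ⊕ p ⊛ ∑! ⊕ q ⊛ ∑!) λ x →
  ≤-trans (*-monoˡ-≤ (w x) (le x)) (≤-reflexive (rearrange (w x) (f x) (g x) b p q))
  where
  rearrange : ∀ w f g b p q → (b + p * f + q * g) * w ≡ b * w + p * (w * f) + q * (w * g)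
  rearrange = solve-∀

module Pentagon {n} (D : Fin n → Fin n → ℕ) (d : ℕ)
  (D-cycle : ∀ x₀ x₁ x₂ x₃ x₄ → d ≤ D x₀ x₁ + D x₁ x₂ + D x₂ x₃ + D x₃ x₄ + D x₄ x₀)
  (w₀ w₁ w₂ w₃ w₄ : Fin n → ℕ) where

  P₀ = ∑ w₀
  P₁ = ∑ w₁
  P₂ = ∑ w₂
  P₃ = ∑ w₃
  P₄ = ∑ w₄
  S₀ = pairSum w₀ w₁ D
  S₁ = pairSum w₁ w₂ D
  S₂ = pairSum w₂ w₃ D
  S₃ = pairSum w₃ w₄ D
  S₄ = pairSum w₄ w₀ D
  into₀ : Fin n → ℕ
  into₀ x = ∑ (λ y → w₀ y * D x y)
  from : (Fin n → ℕ) → Fin n → ℕ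
  from w y = ∑ (λ x → w x * D x y)

  -- `D-cycle` is summed over one variable at a time. Summing over xᵢ turns the two terms at xᵢ into
  -- functions of its neighbours on the cycle and multiplies all others by Pᵢ; once both ends of a
  -- term are summed, it becomes some Sᵢ.
  sum₀ : ∀ x₁ x₂ x₃ x₄ → d * P₀ ≤
    (D x₁ x₂ + D x₂ x₃ + D x₃ x₄) * P₀ + 1 * from w₀ x₁ + 1 * into₀ x₄
  sum₀ x₁ x₂ x₃ x₄ = average w₀ (λ x → D x x₁) (D x₄) d (D x₁ x₂ + D x₂ x₃ + D x₃ x₄) 1 1
    λ x₀ → ≤-trans (D-cycle x₀ x₁ x₂ x₃ x₄) (≤-reflexive (eq (D x₀ x₁) (D x₁ x₂) (D x₂ x₃) (D x₃ x₄) (D x₄ x₀)))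
    where
    eq : ∀ a b c d e → a + b + c + d + e ≡ b + c + d + 1 * a + 1 * e
    eq = solve-∀

  sum₁ : ∀ x₂ x₃ x₄ → d * P₀ * P₁ ≤
    ((D x₂ x₃ + D x₃ x₄) * P₀ + into₀ x₄) * P₁ + 1 * S₀ + P₀ * from w₁ x₂
  sum₁ x₂ x₃ x₄ = subst (λ s → d * P₀ * P₁ ≤ ((D x₂ x₃ + D x₃ x₄) * P₀ + into₀ x₄) * P₁ + 1 * s + P₀ * from w₁ x₂) (pairSum-swap w₀ w₁ D)
    (average w₁ (from w₀) (λ x → D x x₂) (d * P₀) ((D x₂ x₃ + D x₃ x₄) * P₀ + into₀ x₄) 1 P₀
    λ x₁ → ≤-trans (sum₀ x₁ x₂ x₃ x₄) (≤-reflexive (eq P₀ (D x₁ x₂) (D x₂ x₃) (D x₃ x₄) (from w₀ x₁) (into₀ x₄))))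
    where
    eq : ∀ p a b c f g → (a + b + c) * p + 1 * f + 1 * g ≡ (b + c) * p + g + 1 * f + p * a
    eq = solve-∀

  sum₂ : ∀ x₃ x₄ → d * P₀ * P₁ * P₂ ≤
    ((D x₃ x₄ * P₀ + into₀ x₄) * P₁ + S₀) * P₂ + P₀ * S₁ + P₀ * P₁ * from w₂ x₃
  sum₂ x₃ x₄ = subst (λ s → d * P₀ * P₁ * P₂ ≤ ((D x₃ x₄ * P₀ + into₀ x₄) * P₁ + S₀) * P₂ + P₀ * s + P₀ * P₁ * from w₂ x₃) (pairSum-swap w₁ w₂ D)
    (average w₂ (from w₁) (λ x → D x x₃) (d * P₀ * P₁) ((D x₃ x₄ * P₀ + into₀ x₄) * P₁ + S₀) P₀ (P₀ * P₁)
    λ x₂ → ≤-trans (sum₁ x₂ x₃ x₄) (≤-reflexive (eq P₀ P₁ (D x₂ x₃) (D x₃ x₄) S₀ (from w₁ x₂) (into₀ x₄))))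
    where
    eq : ∀ p q a b s f g → ((a + b) * p + g) * q + 1 * s + p * f ≡ (b * p + g) * q + s + p * f + p * q * a
    eq = solve-∀

  sum₃ : ∀ x₄ → d * P₀ * P₁ * P₂ * P₃ ≤
    ((into₀ x₄ * P₁ + S₀) * P₂ + P₀ * S₁) * P₃ + P₀ * P₁ * S₂ + P₀ * P₁ * P₂ * from w₃ x₄
  sum₃ x₄ = subst (λ s → d * P₀ * P₁ * P₂ * P₃ ≤ ((into₀ x₄ * P₁ + S₀) * P₂ + P₀ * S₁) * P₃ + P₀ * P₁ * s + P₀ * P₁ * P₂ * from w₃ x₄) (pairSum-swap w₂ w₃ D)
    (average w₃ (from w₂) (λ x → D x x₄) (d * P₀ * P₁ * P₂) ((into₀ x₄ * P₁ + S₀) * P₂ + P₀ * S₁) (P₀ * P₁) (P₀ * P₁ * P₂)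
    λ x₃ → ≤-trans (sum₂ x₃ x₄) (≤-reflexive (eq P₀ P₁ P₂ (D x₃ x₄) S₀ (P₀ * S₁) (from w₂ x₃) (into₀ x₄))))
    where
    eq : ∀ p q r a s s' f g → ((a * p + g) * q + s) * r + s' + p * q * f ≡ (g * q + s) * r + s' + p * q * f + p * q * r * a
    eq = solve-∀

  sum₄ : d * P₀ * P₁ * P₂ * P₃ * P₄ ≤
    ((S₀ * P₂ + P₀ * S₁) * P₃ + P₀ * P₁ * S₂) * P₄ + P₁ * P₂ * P₃ * S₄ + P₀ * P₁ * P₂ * S₃
  sum₄ = subst (λ s → d * P₀ * P₁ * P₂ * P₃ * P₄ ≤ ((S₀ * P₂ + P₀ * S₁) * P₃ + P₀ * P₁ * S₂) * P₄ + P₁ * P₂ * P₃ * S₄ + P₀ * P₁ * P₂ * s) (pairSum-swap w₃ w₄ D)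
    (average w₄ into₀ (from w₃) (d * P₀ * P₁ * P₂ * P₃) ((S₀ * P₂ + P₀ * S₁) * P₃ + P₀ * P₁ * S₂) (P₁ * P₂ * P₃) (P₀ * P₁ * P₂)
    λ x₄ → ≤-trans (sum₃ x₄) (≤-reflexive (eq P₁ P₂ P₃ S₀ (P₀ * S₁) (P₀ * P₁ * S₂) (P₀ * P₁ * P₂ * from w₃ x₄) (into₀ x₄))))
    where
    eq : ∀ q r u s s' s'' f g → ((g * q + s) * r + s') * u + s'' + f ≡ (s * r + s') * u + s'' + q * r * u * g + f
    eq = solve-∀

  -- Divided by the product of the Pᵢ, `sum₄` says that the densities Sᵢ / (Pᵢ Pᵢ₊₁) add up to at
  -- least d, and each denominator is at least L². The proof multiplies by Π in place of dividing.
  average-pentagon : ∀ L → 0 < L → L ≤ P₀ → L ≤ P₁ → L ≤ P₂ → L ≤ P₃ → L ≤ P₄ →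
    d * (L * L) ≤ S₀ + S₁ + S₂ + S₃ + S₄
  average-pentagon L L>0 l₀ l₁ l₂ l₃ l₄ = *-cancelʳ-≤ _ _ Π {{Π≢0}} (begin
    d * (L * L) * Π ≡⟨ eq₁ d P₀ P₁ P₂ P₃ P₄ (L * L) ⟩
    d * P₀ * P₁ * P₂ * P₃ * P₄ * (L * L) ≤⟨ *-monoˡ-≤ (L * L) sum₄ ⟩
    (((S₀ * P₂ + P₀ * S₁) * P₃ + P₀ * P₁ * S₂) * P₄ + P₁ * P₂ * P₃ * S₄ + P₀ * P₁ * P₂ * S₃) * (L * L)
      ≡⟨ eq₂ P₀ P₁ P₂ P₃ P₄ S₀ S₁ S₂ S₃ S₄ (L * L) ⟩
    S₀ * (P₂ * P₃ * P₄) * (L * L) + S₁ * (P₀ * P₃ * P₄) * (L * L) + S₂ * (P₀ * P₁ * P₄) * (L * L)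
      + S₃ * (P₀ * P₁ * P₂) * (L * L) + S₄ * (P₁ * P₂ * P₃) * (L * L)
      ≤⟨ +-mono-≤ (+-mono-≤ (+-mono-≤ (+-mono-≤ (*-monoʳ-≤ (S₀ * (P₂ * P₃ * P₄)) (*-mono-≤ l₀ l₁))
          (*-monoʳ-≤ (S₁ * (P₀ * P₃ * P₄)) (*-mono-≤ l₁ l₂))) (*-monoʳ-≤ (S₂ * (P₀ * P₁ * P₄)) (*-mono-≤ l₂ l₃)))
          (*-monoʳ-≤ (S₃ * (P₀ * P₁ * P₂)) (*-mono-≤ l₃ l₄))) (*-monoʳ-≤ (S₄ * (P₁ * P₂ * P₃)) (*-mono-≤ l₄ l₀)) ⟩
    S₀ * (P₂ * P₃ * P₄) * (P₀ * P₁) + S₁ * (P₀ * P₃ * P₄) * (P₁ * P₂) + S₂ * (P₀ * P₁ * P₄) * (P₂ * P₃)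
      + S₃ * (P₀ * P₁ * P₂) * (P₃ * P₄) + S₄ * (P₁ * P₂ * P₃) * (P₄ * P₀)
      ≡⟨ eq₃ P₀ P₁ P₂ P₃ P₄ S₀ S₁ S₂ S₃ S₄ ⟩
    (S₀ + S₁ + S₂ + S₃ + S₄) * Π ∎)
    where
    open ≤-Reasoning
    Π = P₀ * P₁ * P₂ * P₃ * P₄
    Π≢0 : NonZero Π
    Π≢0 = >-nonZero (*-mono-< {0} {P₀ * P₁ * P₂ * P₃} {0} (*-mono-< {0} {P₀ * P₁ * P₂} {0} (*-mono-< {0} {P₀ * P₁} {0} (*-mono-< {0} {P₀} {0} (<-≤-trans L>0 l₀) (<-≤-trans L>0 l₁)) (<-≤-trans L>0 l₂)) (<-≤-trans L>0 l₃)) (<-≤-trans L>0 l₄))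
    eq₁ : ∀ d a b c e f L → d * L * (a * b * c * e * f) ≡ d * a * b * c * e * f * L
    eq₁ = solve-∀
    eq₂ : ∀ p₀ p₁ p₂ p₃ p₄ s₀ s₁ s₂ s₃ s₄ L →
      (((s₀ * p₂ + p₀ * s₁) * p₃ + p₀ * p₁ * s₂) * p₄ + p₁ * p₂ * p₃ * s₄ + p₀ * p₁ * p₂ * s₃) * L
      ≡ s₀ * (p₂ * p₃ * p₄) * L + s₁ * (p₀ * p₃ * p₄) * L + s₂ * (p₀ * p₁ * p₄) * L
      + s₃ * (p₀ * p₁ * p₂) * L + s₄ * (p₁ * p₂ * p₃) * L
    eq₂ = solve-∀
    eq₃ : ∀ p₀ p₁ p₂ p₃ p₄ s₀ s₁ s₂ s₃ s₄ →
      s₀ * (p₂ * p₃ * p₄) * (p₀ * p₁) + s₁ * (p₀ * p₃ * p₄) * (p₁ * p₂) + s₂ * (p₀ * p₁ * p₄) * (p₂ * p₃)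
      + s₃ * (p₀ * p₁ * p₂) * (p₃ * p₄) + s₄ * (p₁ * p₂ * p₃) * (p₄ * p₀)
      ≡ (s₀ + s₁ + s₂ + s₃ + s₄) * (p₀ * p₁ * p₂ * p₃ * p₄)
    eq₃ = solve-∀

pairSum-sym : ∀ {n} (v w : Fin n → ℕ) D → (∀ x y → D x y ≡ D y x) → pairSum w v D ≡ pairSum v w D
pairSum-sym v w D D-sym =
  trans (∑-cong λ x → cong (w x *_) (∑-cong λ y → cong (v y *_) (D-sym x y))) (pairSum-swap v w D)

pairSum-linear : ∀ {n} (v w : Fin n → ℕ) f g a →
  pairSum v w (λ x y → f x y + a * g x y) ≡ pairSum v w f + a * pairSum v w g
pairSum-linear {n} v w f g a = ∑-≡ {n} ∑! (∑! ⊕ a ⊛ ∑!) λ x →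
  trans (cong (v x *_) (∑-≡ {n} {b = ∑ (λ y → w y * f x y) + a * ∑ (λ y → w y * g x y)} ∑! (∑! ⊕ a ⊛ ∑!)
    λ y → distrib (w y) (f x y) (g x y) a)) (distrib (v x) _ _ a)
  where
  distrib : ∀ w f g a → w * (f + a * g) ≡ w * f + a * (w * g)
  distrib = solve-∀

-- Linear arithmetic: A ≤ B is a combination of hypotheses, s the slack, and the equation is left to the ring solver.
linear : ∀ {l r A B} s → A ≤ B → l + B + s ≡ r + A → l ≤ r
linear {l} {r} {A} {B} s A≤B eq = +-cancelʳ-≤ B l r (begin
  l + B     ≤⟨ m≤m+n _ s ⟩
  l + B + s ≡⟨ eq ⟩
  r + A     ≤⟨ +-monoʳ-≤ r A≤B ⟩
  r + B     ∎)
  where open ≤-Reasoning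

-- For summing a codegree inequality over a set w of vertices contained in two neighbourhoods w₁ and
-- w₂: the terms X and Y, taken over all of w₁ and w₂, then add up to values of `t`.
restrict : ∀ {w w₁ w₂ h M X Y Z} → w ≤ w₁ → w ≤ w₂ → h + M ≤ X + Y + Z →
  h * w + w * M ≤ w₁ * X + w₂ * Y + Z * w
restrict {w} {w₁} {w₂} {h} {M} {X} {Y} {Z} w≤w₁ w≤w₂ le = begin
  h * w + w * M             ≡⟨ eq w h M ⟩
  w * (h + M)               ≤⟨ *-monoʳ-≤ w le ⟩
  w * (X + Y + Z)           ≡⟨ eq' w X Y Z ⟩
  w * X + w * Y + Z * w     ≤⟨ +-monoˡ-≤ (Z * w) (+-mono-≤ (*-monoˡ-≤ X w≤w₁) (*-monoˡ-≤ Y w≤w₂)) ⟩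
  w₁ * X + w₂ * Y + Z * w   ∎
  where
  open ≤-Reasoning
  eq : ∀ w h M → h * w + w * M ≡ w * (h + M)
  eq = solve-∀
  eq' : ∀ w X Y Z → w * (X + Y + Z) ≡ w * X + w * Y + Z * w
  eq' = solve-∀

penalty-bit : ∀ a C → (C ≤ ⟦ a ⟧ * C + 2 * ⟦ not a ⟧) ⊎ (2 ≤ ⟦ a ⟧ * C + 2 * ⟦ not a ⟧)
penalty-bit false C = inj₂ ≤-refl
penalty-bit true  C = inj₁ (≤-trans (≤-reflexive (≡.sym (*-identityˡ C))) (m≤m+n _ 0))

-- Either every pair so far is adjacent and the codegrees bound the sum, or one penalty has already
-- made it at least 2.
_⊎-+_ : ∀ {a b a' b'} → (a ≤ a') ⊎ (2 ≤ a') → (b ≤ b') ⊎ (2 ≤ b') → (a + b ≤ a' + b') ⊎ (2 ≤ a' + b')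
inj₁ p ⊎-+ inj₁ q = inj₁ (+-mono-≤ p q)
inj₁ _ ⊎-+ inj₂ q = inj₂ (≤-trans q (m≤n+m _ _))
inj₂ p ⊎-+ _      = inj₂ (≤-trans p (m≤m+n _ _))

-- The 5-cycle argument

module FewTriangles {n k h m : ℕ} (G : SimpleGraph n) (reg : IsRegular G k)
  (3k≡n+h : k + k + k ≡ n + h) (2n+2≤5k : n + n + 2 ≤ k + k + k + k + k) (k≤2h : k ≤ h + h)
  (0<m : 0 < m) (200m≤h : 200 * m ≤ h) where

  open Codegree G reg
  open Triangles G reg

  Good : Fin n → Set
  Good x = 8 * t x ≤ m * h

  c-comm : ∀ x y → c x y ≡ c y x
  c-comm x y = ∑-cong (λ z → *-comm ⟦ adj G x z ⟧ ⟦ adj G y z ⟧)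

  h≤-from : ∀ {a} → k + k + k ≤ n + a → h ≤ a
  h≤-from {a} p = +-cancelˡ-≤ n h a (≤-trans (≤-reflexive (≡.sym 3k≡n+h)) p)

  h≤triple : ∀ x y z → h ≤ c x y + c y z + c x z
  h≤triple x y z = h≤-from (triple x y z)

  -- The neighbours of a vertex among the five form at most two arcs of the 5-cycle, so their number
  -- exceeds the number of consecutive pairs among them by at most 2.
  2≤pentagon : ∀ x₀ x₁ x₂ x₃ x₄ → 2 ≤ c x₀ x₁ + c x₁ x₂ + c x₂ x₃ + c x₃ x₄ + c x₄ x₀
  2≤pentagon x₀ x₁ x₂ x₃ x₄ = +-cancelˡ-≤ (n + n) _ _ (≤-trans 2n+2≤5k
    (∑-≤ (deg x₀ ⊕ deg x₁ ⊕ deg x₂ ⊕ deg x₃ ⊕ deg x₄) (∑1 ⊕ ∑1 ⊕ (∑! ⊕ ∑! ⊕ ∑! ⊕ ∑! ⊕ ∑!)) λ i →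
    by-table 5 (λ a b c d e → ⟦ a ⟧ + ⟦ b ⟧ + ⟦ c ⟧ + ⟦ d ⟧ + ⟦ e ⟧)
               (λ a b c d e → 1 + 1 + (⟦ a ⟧ * ⟦ b ⟧ + ⟦ b ⟧ * ⟦ c ⟧ + ⟦ c ⟧ * ⟦ d ⟧ + ⟦ d ⟧ * ⟦ e ⟧ + ⟦ e ⟧ * ⟦ a ⟧)) tt
               (adj G x₀ i) (adj G x₁ i) (adj G x₂ i) (adj G x₃ i) (adj G x₄ i)))

  -- The penalty 2 for a non-adjacent pair makes the sum of D around every 5-tuple at least 2, while the
  -- sum of D over all pairs stays controlled by the number of triangles and of missing edges.
  edgeC nonadj D : Fin n → Fin n → ℕ
  edgeC x y = ⟦ adj G x y ⟧ * c x y
  nonadj x y = ⟦ not (adj G x y) ⟧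
  D x y = edgeC x y + 2 * nonadj x y

  D-cycle : ∀ x₀ x₁ x₂ x₃ x₄ → 2 ≤ D x₀ x₁ + D x₁ x₂ + D x₂ x₃ + D x₃ x₄ + D x₄ x₀
  D-cycle x₀ x₁ x₂ x₃ x₄ = [ ≤-trans (2≤pentagon x₀ x₁ x₂ x₃ x₄) , (λ p → p) ]′
    ((((bit x₀ x₁ ⊎-+ bit x₁ x₂) ⊎-+ bit x₂ x₃) ⊎-+ bit x₃ x₄) ⊎-+ bit x₄ x₀)
    where bit = λ x y → penalty-bit (adj G x y) (c x y)

  -- In a blow-up of C₅ the part of z₀ consists of the vertices adjacent to z₁ and z₄ and to no
  -- other zᵢ. Rotating the arguments gives the other parts.
  only₁₄ : (p₀ p₁ p₂ p₃ p₄ : Bool) → Bool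
  only₁₄ p₀ p₁ p₂ p₃ p₄ = p₄ ∧ p₁ ∧ not p₀ ∧ not p₂ ∧ not p₃

  class : (z₀ z₁ z₂ z₃ z₄ x : Fin n) → ℕ
  class z₀ z₁ z₂ z₃ z₄ x = ⟦ only₁₄ (adj G z₀ x) (adj G z₁ x) (adj G z₂ x) (adj G z₃ x) (adj G z₄ x) ⟧

  -- A vertex adjacent to z₁ and z₄ but not to z₀ is in the class unless it is adjacent to z₂ or z₃,
  -- and then it is a common neighbour of z₁, z₂ or of z₃, z₄.
  class-size : ∀ z₀ z₁ z₂ z₃ z₄ → h ≤ c z₀ z₁ + c z₄ z₀ + c z₁ z₂ + c z₃ z₄ + ∑ (class z₀ z₁ z₂ z₃ z₄)
  class-size z₀ z₁ z₂ z₃ z₄ = h≤-from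
    (∑-≤ (deg z₀ ⊕ deg z₁ ⊕ deg z₄) (∑1 ⊕ (∑! ⊕ ∑! ⊕ ∑! ⊕ ∑! ⊕ ∑!)) λ i →
    by-table 5 (λ p₀ p₁ p₂ p₃ p₄ → ⟦ p₀ ⟧ + ⟦ p₁ ⟧ + ⟦ p₄ ⟧)
               (λ p₀ p₁ p₂ p₃ p₄ → 1 + (⟦ p₀ ⟧ * ⟦ p₁ ⟧ + ⟦ p₄ ⟧ * ⟦ p₀ ⟧ + ⟦ p₁ ⟧ * ⟦ p₂ ⟧ + ⟦ p₃ ⟧ * ⟦ p₄ ⟧
                 + ⟦ only₁₄ p₀ p₁ p₂ p₃ p₄ ⟧)) tt
               (adj G z₀ i) (adj G z₁ i) (adj G z₂ i) (adj G z₃ i) (adj G z₄ i))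

  class-size≤k : ∀ z₀ z₁ z₂ z₃ z₄ → ∑ (class z₀ z₁ z₂ z₃ z₄) ≤ k
  class-size≤k z₀ z₁ z₂ z₃ z₄ = ∑-≤ ∑! (deg z₁) λ i →
    by-table 5 (λ p₀ p₁ p₂ p₃ p₄ → ⟦ only₁₄ p₀ p₁ p₂ p₃ p₄ ⟧) (λ p₀ p₁ p₂ p₃ p₄ → ⟦ p₁ ⟧) tt
               (adj G z₀ i) (adj G z₁ i) (adj G z₂ i) (adj G z₃ i) (adj G z₄ i)

  -- This is `triple` for x, z₁, z₄ with its slack kept: a vertex adjacent to none of the three has
  -- slack 1, and a member of the class of z₁ is adjacent to neither z₁ nor z₄.
  nonneighbours : ∀ z₀ z₁ z₂ z₃ z₄ x →
    h + ∑ (λ y → class z₁ z₂ z₃ z₄ z₀ y * nonadj x y) ≤ c z₄ x + c z₁ x + c z₄ z₁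
  nonneighbours z₀ z₁ z₂ z₃ z₄ x = +-cancelˡ-≤ n _ _ (≤-trans
    (≤-reflexive (trans (≡.sym (+-assoc n h _)) (cong (_+ ∑ (λ y → class z₁ z₂ z₃ z₄ z₀ y * nonadj x y)) (≡.sym 3k≡n+h))))
    (∑-≤ (deg x ⊕ deg z₁ ⊕ deg z₄ ⊕ ∑!) (∑1 ⊕ (∑! ⊕ ∑! ⊕ ∑!)) λ i →
    by-table 6 (λ e p₀ p₁ p₂ p₃ p₄ → ⟦ e ⟧ + ⟦ p₁ ⟧ + ⟦ p₄ ⟧ + ⟦ only₁₄ p₁ p₂ p₃ p₄ p₀ ⟧ * ⟦ not e ⟧)
               (λ e p₀ p₁ p₂ p₃ p₄ → 1 + (⟦ p₄ ⟧ * ⟦ e ⟧ + ⟦ p₁ ⟧ * ⟦ e ⟧ + ⟦ p₄ ⟧ * ⟦ p₁ ⟧)) tt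
               (adj G x i) (adj G z₀ i) (adj G z₁ i) (adj G z₂ i) (adj G z₃ i) (adj G z₄ i)))

  missing : (z₀ z₁ z₂ z₃ z₄ : Fin n) → ℕ
  missing z₀ z₁ z₂ z₃ z₄ = pairSum (class z₀ z₁ z₂ z₃ z₄) (class z₁ z₂ z₃ z₄ z₀) nonadj

  -- Sum `nonneighbours` over x in the class of z₀. Such x are neighbours of both z₄ and z₁, which
  -- brings in `t z₄` and `t z₁`.
  missing-bound : ∀ z₀ z₁ z₂ z₃ z₄ →
    h * ∑ (class z₀ z₁ z₂ z₃ z₄) + missing z₀ z₁ z₂ z₃ z₄ ≤ t z₄ + t z₁ + c z₄ z₁ * ∑ (class z₀ z₁ z₂ z₃ z₄)
  missing-bound z₀ z₁ z₂ z₃ z₄ = ∑-≤ (h ⊛ ∑! ⊕ ∑!) (∑! ⊕ ∑! ⊕ c z₄ z₁ ⊛ ∑!) λ x →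
    let r = not (adj G z₀ x) ∧ not (adj G z₂ x) ∧ not (adj G z₃ x) in
    restrict (by-table 3 (λ p q r → ⟦ p ∧ q ∧ r ⟧) (λ p q r → ⟦ p ⟧) tt (adj G z₄ x) (adj G z₁ x) r)
      (by-table 3 (λ p q r → ⟦ p ∧ q ∧ r ⟧) (λ p q r → ⟦ q ⟧) tt (adj G z₄ x) (adj G z₁ x) r)
      (nonneighbours z₀ z₁ z₂ z₃ z₄ x)

  -- By the triple z₁, z₂, z₃ the vertices z₁ and z₃ have many common neighbours. Inside the k
  -- neighbours of z₁, those shared with z₄ overlap these in at most `c z₃ z₄` vertices.
  distance-two : ∀ z₁ z₂ z₃ z₄ → c z₄ z₁ + h ≤ k + (c z₃ z₄ + c z₁ z₂ + c z₂ z₃)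
  distance-two z₁ z₂ z₃ z₄ = linear 0 (+-mono-≤ union≤k (h≤triple z₁ z₂ z₃))
    (eq (c z₄ z₁) (c z₁ z₃) (c z₃ z₄) (c z₁ z₂) (c z₂ z₃) h k)
    where
    union≤k : c z₄ z₁ + c z₁ z₃ ≤ k + c z₃ z₄
    union≤k = ∑-≤ (∑! ⊕ ∑!) (deg z₁ ⊕ ∑!) λ i →
      by-table 3 (λ p₁ p₃ p₄ → ⟦ p₄ ⟧ * ⟦ p₁ ⟧ + ⟦ p₁ ⟧ * ⟦ p₃ ⟧) (λ p₁ p₃ p₄ → ⟦ p₁ ⟧ + ⟦ p₃ ⟧ * ⟦ p₄ ⟧) tt
        (adj G z₁ i) (adj G z₃ i) (adj G z₄ i)
    eq : ∀ a b c d e h k → a + h + (k + c + (d + e + b)) + 0 ≡ k + (c + d + e) + (a + b + h)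
    eq = solve-∀

  -- `distance-two` gives `c z₄ z₁` ≤ h + 3m and the class has at most 2h members, so `missing` is
  -- at most `t z₄ + t z₁` + 6mh. Multiplied by 8 this is at most (1 + 1 + 48)mh.
  missing≤ : ∀ z₀ z₁ z₂ z₃ z₄ → Good z₁ → Good z₄ → c z₁ z₂ ≤ m → c z₂ z₃ ≤ m → c z₃ z₄ ≤ m →
    8 * missing z₀ z₁ z₂ z₃ z₄ ≤ 50 * (m * h)
  missing≤ z₀ z₁ z₂ z₃ z₄ g₁ g₄ s₁ s₂ s₃ = arith h m (t z₁) (t z₄) _ _ _ g₁ g₄
      (missing-bound z₀ z₁ z₂ z₃ z₄)
      (+-cancelʳ-≤ h _ _ (≤-trans (distance-two z₁ z₂ z₃ z₄) (≤-trans (+-mono-≤ k≤2h (+-mono-≤ (+-mono-≤ s₃ s₁) s₂))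
        (≤-reflexive (eq₁ h m)))))
      (≤-trans (class-size≤k z₀ z₁ z₂ z₃ z₄) k≤2h)
    where
    eq₁ : ∀ h m → h + h + (m + m + m) ≡ h + 3 * m + h
    eq₁ = solve-∀
    arith : ∀ h m t₁ t₄ c w M → 8 * t₁ ≤ m * h → 8 * t₄ ≤ m * h → h * w + M ≤ t₄ + t₁ + c * w →
      c ≤ h + 3 * m → w ≤ h + h → 8 * M ≤ 50 * (m * h)
    arith h m t₁ t₄ c w M g₁ g₄ b c≤ w≤ = linear 0
      (+-mono-≤ (+-mono-≤ g₁ g₄) (+-mono-≤ (*-monoʳ-≤ 8 (≤-trans b (+-monoʳ-≤ (t₄ + t₁) (*-monoˡ-≤ w c≤))))
        (*-monoʳ-≤ (24 * m) w≤)))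
      (eq h m t₁ t₄ w M)
      where
      eq : ∀ h m t₁ t₄ w M →
        8 * M + (m * h + m * h + (8 * (t₄ + t₁ + (h + 3 * m) * w) + 24 * m * (h + h))) + 0
        ≡ 50 * (m * h) + (8 * t₁ + 8 * t₄ + (8 * (h * w + M) + 24 * m * w))
      eq = solve-∀

  edgeC-sym : ∀ x y → edgeC x y ≡ edgeC y x
  edgeC-sym x y = cong₂ _*_ (cong ⟦_⟧ (sym G x y)) (c-comm x y)

  -- Edges between consecutive classes

  module _ (z₀ z₁ z₂ z₃ z₄ : Fin n) where
    W₀ = class z₀ z₁ z₂ z₃ z₄
    W₁ = class z₁ z₂ z₃ z₄ z₀
    W₂ = class z₂ z₃ z₄ z₀ z₁
    W₃ = class z₃ z₄ z₀ z₁ z₂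
    W₄ = class z₄ z₀ z₁ z₂ z₃

    classes-disjoint : ∀ x y →
      W₀ x * W₁ y + W₁ x * W₂ y + W₂ x * W₃ y + W₃ x * W₄ y + W₄ x * W₀ y +
      (W₁ x * W₀ y + W₂ x * W₁ y + W₃ x * W₂ y + W₄ x * W₃ y + W₀ x * W₄ y) ≤ 1
    classes-disjoint x y = by-table 10
      (λ p₀ p₁ p₂ p₃ p₄ q₀ q₁ q₂ q₃ q₄ →
        let v₀ = ⟦ only₁₄ p₀ p₁ p₂ p₃ p₄ ⟧ ; w₀ = ⟦ only₁₄ q₀ q₁ q₂ q₃ q₄ ⟧
            v₁ = ⟦ only₁₄ p₁ p₂ p₃ p₄ p₀ ⟧ ; w₁ = ⟦ only₁₄ q₁ q₂ q₃ q₄ q₀ ⟧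
            v₂ = ⟦ only₁₄ p₂ p₃ p₄ p₀ p₁ ⟧ ; w₂ = ⟦ only₁₄ q₂ q₃ q₄ q₀ q₁ ⟧
            v₃ = ⟦ only₁₄ p₃ p₄ p₀ p₁ p₂ ⟧ ; w₃ = ⟦ only₁₄ q₃ q₄ q₀ q₁ q₂ ⟧
            v₄ = ⟦ only₁₄ p₄ p₀ p₁ p₂ p₃ ⟧ ; w₄ = ⟦ only₁₄ q₄ q₀ q₁ q₂ q₃ ⟧
        in v₀ * w₁ + v₁ * w₂ + v₂ * w₃ + v₃ * w₄ + v₄ * w₀ + (v₁ * w₀ + v₂ * w₁ + v₃ * w₂ + v₄ * w₃ + v₀ * w₄))
      (λ _ _ _ _ _ _ _ _ _ _ → 1) tt
      (adj G z₀ x) (adj G z₁ x) (adj G z₂ x) (adj G z₃ x) (adj G z₄ x)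
      (adj G z₀ y) (adj G z₁ y) (adj G z₂ y) (adj G z₃ y) (adj G z₄ y)

    E₀ = pairSum W₀ W₁ edgeC
    E₁ = pairSum W₁ W₂ edgeC
    E₂ = pairSum W₂ W₃ edgeC
    E₃ = pairSum W₃ W₄ edgeC
    E₄ = pairSum W₄ W₀ edgeC

    -- The classes are disjoint, so an ordered pair lies in at most one of the ten products of
    -- consecutive classes; the two directions give each Eᵢ twice.
    edges-once : E₀ + E₁ + E₂ + E₃ + E₄ + (E₀ + E₁ + E₂ + E₃ + E₄) ≤ ∑ t
    edges-once = subst (λ s → E₀ + E₁ + E₂ + E₃ + E₄ + s ≤ ∑ t)
      (cong₂ _+_ (cong₂ _+_ (cong₂ _+_ (cong₂ _+_ (flip W₀ W₁) (flip W₁ W₂)) (flip W₂ W₃)) (flip W₃ W₄)) (flip W₄ W₀))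
      (∑-≤ (∑! ⊕ ∑! ⊕ ∑! ⊕ ∑! ⊕ ∑! ⊕ (∑! ⊕ ∑! ⊕ ∑! ⊕ ∑! ⊕ ∑!)) ∑! λ x →
        ∑-≤ (W₀ x ⊛ ∑! ⊕ W₁ x ⊛ ∑! ⊕ W₂ x ⊛ ∑! ⊕ W₃ x ⊛ ∑! ⊕ W₄ x ⊛ ∑!
             ⊕ (W₁ x ⊛ ∑! ⊕ W₂ x ⊛ ∑! ⊕ W₃ x ⊛ ∑! ⊕ W₄ x ⊛ ∑! ⊕ W₀ x ⊛ ∑!)) ∑! λ y →
          ≤-trans (≤-reflexive (eq (W₀ x) (W₁ x) (W₂ x) (W₃ x) (W₄ x) (W₀ y) (W₁ y) (W₂ y) (W₃ y) (W₄ y) (edgeC x y)))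
            (≤-trans (*-monoˡ-≤ (edgeC x y) (classes-disjoint x y)) (≤-reflexive (*-identityˡ _))))
      where
      flip = λ v w → pairSum-sym v w edgeC edgeC-sym
      eq : ∀ v₀ v₁ v₂ v₃ v₄ w₀ w₁ w₂ w₃ w₄ e →
        v₀ * (w₁ * e) + v₁ * (w₂ * e) + v₂ * (w₃ * e) + v₃ * (w₄ * e) + v₄ * (w₀ * e)
        + (v₁ * (w₀ * e) + v₂ * (w₁ * e) + v₃ * (w₂ * e) + v₄ * (w₃ * e) + v₀ * (w₄ * e))
        ≡ (v₀ * w₁ + v₁ * w₂ + v₂ * w₃ + v₃ * w₄ + v₄ * w₀ + (v₁ * w₀ + v₂ * w₁ + v₃ * w₂ + v₄ * w₃ + v₀ * w₄)) * e
      eq = solve-∀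

    open Pentagon D 2 D-cycle W₀ W₁ W₂ W₃ W₄ using (average-pentagon)

    no-pentagon : 2 * ∑ t ≤ 3 * (k * h) → Good z₀ → Good z₁ → Good z₂ → Good z₃ → Good z₄ →
      c z₀ z₁ ≤ m → c z₁ z₂ ≤ m → c z₂ z₃ ≤ m → c z₃ z₄ ≤ m → c z₄ z₀ ≤ m → ⊥
    -- Writing h = 200m + d, each class has at least L = 196m + d members, since four codegrees of
    -- at most m are lost in `class-size`.
    no-pentagon τ g₀ g₁ g₂ g₃ g₄ s₀ s₁ s₂ s₃ s₄ with d , refl ← m≤n⇒∃[o]m+o≡n 200m≤h = <⇒≱ pos (contradictory m d
      (≤-trans (*-monoʳ-≤ 4 (average-pentagon (196 * m + d) (<-≤-trans 0<m (≤-trans (m≤m+n m (195 * m)) (m≤m+n _ d)))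
        (size s₀ s₄ s₁ s₃ (class-size z₀ z₁ z₂ z₃ z₄)) (size s₁ s₀ s₂ s₄ (class-size z₁ z₂ z₃ z₄ z₀))
        (size s₂ s₁ s₃ s₀ (class-size z₂ z₃ z₄ z₀ z₁)) (size s₃ s₂ s₄ s₁ (class-size z₃ z₄ z₀ z₁ z₂))
        (size s₄ s₃ s₀ s₂ (class-size z₄ z₀ z₁ z₂ z₃))))
        (≤-trans (≤-reflexive (trans (cong (4 *_) (cong₂ _+_ (cong₂ _+_ (cong₂ _+_ (cong₂ _+_ (split W₀ W₁) (split W₁ W₂)) (split W₂ W₃)) (split W₃ W₄)) (split W₄ W₀)))
          (eq E₀ E₁ E₂ E₃ E₄ (missing z₀ z₁ z₂ z₃ z₄) (missing z₁ z₂ z₃ z₄ z₀) (missing z₂ z₃ z₄ z₀ z₁) (missing z₃ z₄ z₀ z₁ z₂) (missing z₄ z₀ z₁ z₂ z₃))))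
        (+-mono-≤ (≤-trans (*-monoʳ-≤ 2 edges-once) (≤-trans τ (*-monoʳ-≤ 3 (*-monoˡ-≤ (200 * m + d) k≤2h))))
          (+-mono-≤ (+-mono-≤ (+-mono-≤ (+-mono-≤
            (missing≤ z₀ z₁ z₂ z₃ z₄ g₁ g₄ s₁ s₂ s₃) (missing≤ z₁ z₂ z₃ z₄ z₀ g₂ g₀ s₂ s₃ s₄))
            (missing≤ z₂ z₃ z₄ z₀ z₁ g₃ g₁ s₃ s₄ s₀)) (missing≤ z₃ z₄ z₀ z₁ z₂ g₄ g₂ s₄ s₀ s₁))
            (missing≤ z₄ z₀ z₁ z₂ z₃ g₀ g₃ s₀ s₁ s₂))))))
      where
      pos : 0 < m * m
      pos = *-mono-< 0<m 0<m
      size : ∀ {a b e f w d} → a ≤ m → b ≤ m → e ≤ m → f ≤ m → 200 * m + d ≤ a + b + e + f + w → 196 * m + d ≤ w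
      size {w = w} {d} a b e f le = linear 0 (≤-trans le (+-monoˡ-≤ w (+-mono-≤ (+-mono-≤ (+-mono-≤ a b) e) f))) (eq m d w)
        where
        eq : ∀ m d w → 196 * m + d + (m + m + m + m + w) + 0 ≡ w + (200 * m + d)
        eq = solve-∀
      split = λ v w → pairSum-linear v w edgeC nonadj 2
      eq : ∀ a b c d e a' b' c' d' e' →
        4 * (a + 2 * a' + (b + 2 * b') + (c + 2 * c') + (d + 2 * d') + (e + 2 * e'))
        ≡ 2 * (a + b + c + d + e + (a + b + c + d + e)) + (8 * a' + 8 * b' + 8 * c' + 8 * d' + 8 * e')
      eq = solve-∀
      -- The hypothesis reads 8(h - 4m)² ≤ 6h² + 250mh, that is 2h² + 128m² ≤ 314mh, which fails for
      -- h ≥ 200m > 0.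
      contradictory : ∀ m d → let L = 196 * m + d ; h = 200 * m + d ; u = 50 * (m * h) in
        4 * (2 * (L * L)) ≤ 3 * ((h + h) * h) + (u + u + u + u + u) → m * m ≤ 0
      contradictory m d le = linear (17327 * (m * m) + 486 * (m * d) + 2 * (d * d)) le (eq' m d)
        where
        eq' : ∀ m d → let L = 196 * m + d ; h = 200 * m + d ; u = 50 * (m * h) in
          m * m + (3 * ((h + h) * h) + (u + u + u + u + u)) + (17327 * (m * m) + 486 * (m * d) + 2 * (d * d))
          ≡ 0 + 4 * (2 * (L * L))
        eq' = solve-∀

-- Boolean comparisons

≰ᵇ⇒> : ∀ {a b} → (a ≤ᵇ b) ≡ false → b < a
≰ᵇ⇒> {a} {b} p = ≰⇒> λ a≤b → subst T p (≤⇒≤ᵇ a≤b)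

≮ᵇ⇒≥ : ∀ {a b} → (a <ᵇ b) ≡ false → b ≤ a
≮ᵇ⇒≥ {a} {b} p = ≮⇒≥ λ a<b → subst T p (<⇒<ᵇ a<b)

≡true⇒≤ : ∀ {a b} → (a ≤ᵇ b) ≡ true → a ≤ b
≡true⇒≤ p = ≤ᵇ⇒≤ _ _ (Equivalence.from T-≡ p)

≡true⇒< : ∀ {a b} → (a <ᵇ b) ≡ true → a < b
≡true⇒< p = <ᵇ⇒< _ _ (Equivalence.from T-≡ p)

-- The bipartition

module Colouring {n k h m : ℕ} (G : SimpleGraph n) (reg : IsRegular G k)
  (3k≡n+h : k + k + k ≡ n + h) (2n+2≤5k : n + n + 2 ≤ k + k + k + k + k) (k≤2h : k ≤ h + h)
  (0<m : 0 < m) (200m≤h : 200 * m ≤ h) (h≤201m : h ≤ 201 * m) (19296≤h : 19296 ≤ h)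
  (4T≤kh : 4 * triangleCount G ≤ k * h) where

  open Codegree G reg
  open Triangles G reg
  open FewTriangles {m = m} G reg 3k≡n+h 2n+2≤5k k≤2h 0<m 200m≤h

  0<h : 0 < h
  0<h = ≤-trans (s≤s z≤n) 19296≤h

  instance
    h-nonZero : NonZero h
    h-nonZero = >-nonZero 0<h
    m-nonZero : NonZero m
    m-nonZero = >-nonZero 0<m

  2∑t≤3kh : 2 * ∑ t ≤ 3 * (k * h)
  2∑t≤3kh = ≤-trans (*-monoʳ-≤ 2 ∑t≤6triangles) (≤-trans (≤-reflexive (eq (triangleCount G))) (*-monoʳ-≤ 3 4T≤kh))
    where
    eq : ∀ a → 2 * (6 * a) ≡ 3 * (4 * a)
    eq = solve-∀

  bad : Fin n → Bool
  bad x = not (8 * t x ≤ᵇ m * h)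

  ¬bad⇒Good : ∀ {x} → bad x ≡ false → Good x
  ¬bad⇒Good {x} p with 8 * t x ≤ᵇ m * h in q
  ... | true = ≡true⇒≤ q

  bads : ℕ
  bads = ∑ (λ x → ⟦ bad x ⟧)

  -- 4824 = 24 · 201, from m · bads ≤ 12k ≤ 24h ≤ 24 · 201m
  bads≤ : bads ≤ 4824
  bads≤ = *-cancelˡ-≤ m (*-cancelˡ-≤ h (*-cancelˡ-≤ 2 (linear 0
    (+-mono-≤ (+-mono-≤ (*-monoʳ-≤ 2 weight) (*-monoʳ-≤ 8 2∑t≤3kh)) (+-mono-≤ (*-monoʳ-≤ (24 * h) k≤2h) (*-monoʳ-≤ (48 * h) h≤201m)))
    (eq m h bads (∑ t) k))))
    where
    weight : m * h * bads ≤ 8 * ∑ t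
    weight = ∑-≤ ((m * h) ⊛ ∑!) (8 ⊛ ∑!) pointwise
      where
      pointwise : ∀ x → m * h * ⟦ bad x ⟧ ≤ 8 * t x
      pointwise x with 8 * t x ≤ᵇ m * h in q
      ... | true  = ≤-trans (≤-reflexive (*-zeroʳ (m * h))) z≤n
      ... | false = ≤-trans (≤-reflexive (*-identityʳ (m * h))) (<⇒≤ (≰ᵇ⇒> q))
    eq : ∀ m h b s k → 2 * (h * (m * b)) + (2 * (8 * s) + 8 * (3 * (k * h)) + (24 * h * (h + h) + 48 * h * (201 * m))) + 0
      ≡ 2 * (h * (m * 4824)) + (2 * (m * h * b) + 8 * (2 * s) + (24 * h * k + 48 * h * h))
    eq = solve-∀

  heavy : Fin n → ℕ
  heavy x = ∑ (λ y → ⟦ adj G x y ⟧ * ⟦ m <ᵇ c x y ⟧)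

  m*heavy≤t : ∀ x → m * heavy x ≤ t x
  m*heavy≤t x = ∑-≤ (m ⊛ ∑!) ∑! pointwise
    where
    pointwise : ∀ y → m * (⟦ adj G x y ⟧ * ⟦ m <ᵇ c x y ⟧) ≤ ⟦ adj G x y ⟧ * c x y
    pointwise y with adj G x y
    ... | false = ≤-reflexive (*-zeroʳ m)
    ... | true with m <ᵇ c x y in q
    ...   | false = ≤-trans (≤-reflexive (*-zeroʳ m)) z≤n
    ...   | true  = ≤-trans (≤-reflexive (*-identityʳ m)) (≤-trans (<⇒≤ (≡true⇒< q)) (m≤m+n _ 0))

  heavy≤ : ∀ {x} → Good x → 8 * heavy x ≤ h
  heavy≤ {x} g = *-cancelˡ-≤ m (≤-trans (≤-reflexive (eq m (heavy x))) (≤-trans (*-monoʳ-≤ 8 (m*heavy≤t x)) g))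
    where
    eq : ∀ m a → m * (8 * a) ≡ 8 * (m * a)
    eq = solve-∀

  -- Sum `h≤triple u y x` over the common neighbours y of u and x.
  codegree-gap : ∀ u x → h * c u x ≤ t u + t x + c u x * c u x
  codegree-gap u x = ∑-≤ (h ⊛ ∑!) (∑! ⊕ ∑! ⊕ c u x ⊛ ∑!) λ y →
    ≤-trans (m≤m+n _ _) (restrict {M = 0}
      (by-table 2 (λ p q → ⟦ p ⟧ * ⟦ q ⟧) (λ p q → ⟦ p ⟧) tt (adj G u y) (adj G x y))
      (by-table 2 (λ p q → ⟦ p ⟧ * ⟦ q ⟧) (λ p q → ⟦ q ⟧) tt (adj G u y) (adj G x y))
      (≤-trans (≤-reflexive (+-identityʳ h)) (≤-trans (h≤triple u y x) (+-monoˡ-≤ (c u x)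
        (+-monoʳ-≤ (c u y) (≤-reflexive (c-comm y x)))))))

  -- For good u and x, `codegree-gap` gives c(h - c) ≤ mh/4. If 2c ≤ h, then h - c ≥ h/2 and hence
  -- 2c ≤ m.
  not-small⇒large : ∀ {u x} → Good u → Good x → m < c u x → h < c u x + c u x
  not-small⇒large {u} {x} gu gx m<c = ≰⇒> λ 2c≤h → <⇒≱ m<c (≤-trans (m≤m+n _ _)
    (*-cancelˡ-≤ h (*-cancelˡ-≤ 2 (linear 0
      (+-mono-≤ (+-mono-≤ gu gx) (+-mono-≤ (*-monoʳ-≤ 8 (codegree-gap u x)) (*-monoʳ-≤ (4 * c u x) 2c≤h)))
      (eq m h (c u x) (t u) (t x))))))
    where
    eq : ∀ m h c t t' → 2 * (h * (c + c)) + (m * h + m * h + (8 * (t + t' + c * c) + 4 * c * h)) + 0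
      ≡ 2 * (h * m) + (8 * t + 8 * t' + (8 * (h * c) + 4 * c * (c + c)))
    eq = solve-∀

  -- If no good y is light to both u and x, each of their common neighbours is bad or joined to u or
  -- x by a heavy edge. Then c(u,x) ≤ h/8 + h/8 + 4824 ≤ h/2, because 19296 = 4 · 4824.
  light-path : ∀ {u x} → Good u → Good x → m < c u x →
    (∀ y → Good y → c u y ≤ m → c x y ≤ m → ⊥) → ⊥
  light-path {u} {x} gu gx m<c none = <⇒≱ (not-small⇒large gu gx m<c) (*-cancelˡ-≤ 4 (linear 0
    (+-mono-≤ (+-mono-≤ (heavy≤ gu) (heavy≤ gx)) (+-mono-≤ (*-monoʳ-≤ 8 count) (+-mono-≤ (*-monoʳ-≤ 8 bads≤) (*-monoʳ-≤ 2 19296≤h))))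
    (eq (heavy u) (heavy x) bads h (c u x))))
    where
    pointwise : ∀ y → ⟦ adj G u y ⟧ * ⟦ adj G x y ⟧ ≤
      ⟦ adj G u y ⟧ * ⟦ m <ᵇ c u y ⟧ + ⟦ adj G x y ⟧ * ⟦ m <ᵇ c x y ⟧ + ⟦ bad y ⟧
    pointwise y with m <ᵇ c u y in p | m <ᵇ c x y in q | bad y in r
    ... | false | false | false = ⊥-elim (none y (¬bad⇒Good r) (≮ᵇ⇒≥ p) (≮ᵇ⇒≥ q))
    ... | true | _ | _ = ≤-trans (*-monoʳ-≤ ⟦ adj G u y ⟧ (bit≤1 (adj G x y))) (≤-trans (m≤m+n _ _) (m≤m+n _ _))
      where
      bit≤1 : ∀ b → ⟦ b ⟧ ≤ 1
      bit≤1 = by-table 1 ⟦_⟧ (λ _ → 1) tt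
    ... | false | true | b = by-table 3 (λ p q b → ⟦ p ⟧ * ⟦ q ⟧) (λ p q b → ⟦ p ⟧ * 0 + ⟦ q ⟧ * 1 + ⟦ b ⟧) tt (adj G u y) (adj G x y) b
    ... | false | false | true = by-table 2 (λ p q → ⟦ p ⟧ * ⟦ q ⟧) (λ p q → ⟦ p ⟧ * 0 + ⟦ q ⟧ * 0 + 1) tt (adj G u y) (adj G x y)
    count : c u x ≤ heavy u + heavy x + bads
    count = ∑-≤ ∑! (∑! ⊕ ∑! ⊕ ∑!) pointwise
    eq : ∀ a b d h c → 4 * (c + c) + (h + h + (8 * (a + b + d) + (8 * 4824 + 2 * h))) + 0
      ≡ 4 * h + (8 * a + 8 * b + (8 * c + (8 * d + 2 * 19296)))
    eq = solve-∀

  colouring : ∃[ col ] (∀ x y → Good x → Good y → c x y ≤ m → col x ≡ col y → ⊥)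
  colouring with any? (λ u → 8 * t u ≤? m * h)
  ... | no none = (λ _ → true) , λ x _ gx _ _ _ → none (x , gx)
  ... | yes (u , gu) = (λ x → c u x ≤ᵇ m) , proper
    where
    proper : ∀ x y → Good x → Good y → c x y ≤ m → (c u x ≤ᵇ m) ≡ (c u y ≤ᵇ m) → ⊥
    proper x y gx gy s same with c u x ≤ᵇ m in p | c u y ≤ᵇ m in q
    -- Here u, x, y are pairwise light, so h ≤ 3m.
    ... | true | true = <⇒≱ (<-≤-trans (*-monoˡ-< m {3} {200} (≤ᵇ⇒≤ 4 200 tt)) 200m≤h)
      (≤-trans (h≤triple u x y) (≤-trans (+-mono-≤ (+-mono-≤ (≡true⇒≤ {c u x} {m} p) s) (≡true⇒≤ {c u y} {m} q)) (≤-reflexive (eq m))))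
      where
      eq : ∀ m → m + m + m ≡ 3 * m
      eq = solve-∀
    -- The light paths u, v, x and u, w, y close up with the light pair x, y to a 5-walk.
    ... | false | false =
      light-path gu gx (≰ᵇ⇒> p) λ v gv uv xv →
      light-path gu gy (≰ᵇ⇒> q) λ w gw uw yw →
      no-pentagon u v x y w 2∑t≤3kh gu gv gx gy gw uv (subst (_≤ m) (c-comm x v) xv) s yw (subst (_≤ m) (c-comm u w) uw)

  monochromatic : (Fin n → Bool) → ℕ
  monochromatic col = ∑ (λ x → ∑ (λ y → ⟦ adj G x y ∧ not (col x xor col y) ⟧))

  -- A monochromatic edge has a bad end or is heavy. In ordered pairs, bad ends account for at most
  -- 2k · 4824 and heavy edges for at most ∑ t / m ≤ 3kh / (2m). Doubling gives (4 · 4824 + 3 ·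
  -- 201)k = 19899k, leaving a slack of 101k.
  monochromatic≤ : ∀ col → (∀ x y → Good x → Good y → c x y ≤ m → col x ≡ col y → ⊥) →
    2 * monochromatic col ≤ 20000 * k
  monochromatic≤ col proper = *-cancelˡ-≤ m (linear (101 * (k * m))
    (+-mono-≤ (+-mono-≤ (*-monoʳ-≤ (2 * m) bound) (*-monoʳ-≤ (4 * m * k) bads≤))
      (+-mono-≤ (*-monoʳ-≤ 2 heavies) (+-mono-≤ 2∑t≤3kh (*-monoʳ-≤ (3 * k) h≤201m))))
    (eq m k h (monochromatic col) bads (∑ heavy) (∑ t)))
    where
    eq : ∀ m k h M b H s → m * (2 * M) + (2 * m * (k * b + k * b + H) + 4 * m * k * 4824 + (2 * s + (3 * (k * h) + 3 * k * (201 * m)))) + 101 * (k * m)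
      ≡ m * (20000 * k) + (2 * m * M + 4 * m * k * b + (2 * (m * H) + (2 * s + 3 * k * h)))
    eq = solve-∀
    heavies : m * ∑ heavy ≤ ∑ t
    heavies = ∑-≤ (m ⊛ ∑!) ∑! m*heavy≤t
    badNeighbours : Fin n → ℕ
    badNeighbours x = ∑ (λ y → ⟦ bad y ⟧ * ⟦ adj G x y ⟧)
    ∑badNeighbours : ∑ badNeighbours ≡ k * bads
    ∑badNeighbours = trans (∑-swap {n} {n} _) (∑-≡ {n} ∑! (k ⊛ ∑!) λ y →
      trans (∑-≡ {n} {b = ⟦ bad y ⟧ * k} ∑! (⟦ bad y ⟧ ⊛ deg y) λ x → cong (λ b → ⟦ bad y ⟧ * ⟦ b ⟧) (sym G x y)) (*-comm ⟦ bad y ⟧ k))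
    pointwise : ∀ x y → ⟦ adj G x y ∧ not (col x xor col y) ⟧ ≤
      ⟦ bad x ⟧ * ⟦ adj G x y ⟧ + ⟦ bad y ⟧ * ⟦ adj G x y ⟧ + ⟦ adj G x y ⟧ * ⟦ m <ᵇ c x y ⟧
    pointwise x y with bad x in p | bad y in q | m <ᵇ c x y in r | col x in s | col y in s'
    ... | false | false | false | true  | true  = ⊥-elim (proper x y (¬bad⇒Good p) (¬bad⇒Good q) (≮ᵇ⇒≥ r) (trans s (≡.sym s')))
    ... | false | false | false | false | false = ⊥-elim (proper x y (¬bad⇒Good p) (¬bad⇒Good q) (≮ᵇ⇒≥ r) (trans s (≡.sym s')))
    ... | false | false | false | true  | false = ≤-trans (≤-reflexive (cong ⟦_⟧ (∧-zeroʳ (adj G x y)))) z≤n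
    ... | false | false | false | false | true  = ≤-trans (≤-reflexive (cong ⟦_⟧ (∧-zeroʳ (adj G x y)))) z≤n
    ... | false | false | true  | a | b = by-table 3 (λ e a b → ⟦ e ∧ not (a xor b) ⟧) (λ e a b → ⟦ e ⟧ * 1) tt (adj G x y) a b
    ... | false | true  | r     | a | b = by-table 4 (λ e r a b → ⟦ e ∧ not (a xor b) ⟧) (λ e r a b → 1 * ⟦ e ⟧ + ⟦ e ⟧ * ⟦ r ⟧) tt (adj G x y) r a b
    ... | true  | q     | r     | a | b = by-table 5 (λ e q r a b → ⟦ e ∧ not (a xor b) ⟧) (λ e q r a b → 1 * ⟦ e ⟧ + ⟦ q ⟧ * ⟦ e ⟧ + ⟦ e ⟧ * ⟦ r ⟧) tt (adj G x y) q r a b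
    bound : monochromatic col ≤ k * bads + k * bads + ∑ heavy
    bound = subst (λ s → monochromatic col ≤ k * bads + s + ∑ heavy) ∑badNeighbours
      (∑-≤ ∑! (k ⊛ ∑! ⊕ ∑! ⊕ ∑!) λ x →
        ≤-trans (∑-≤ {b = ⟦ bad x ⟧ * k + badNeighbours x + heavy x} ∑! (⟦ bad x ⟧ ⊛ deg x ⊕ ∑! ⊕ ∑!) (pointwise x))
          (≤-reflexive (cong (λ s → s + badNeighbours x + heavy x) (*-comm ⟦ bad x ⟧ k))))

-- Deleting the monochromatic edges, and the final estimates

bipartition : ∀ {n} → SimpleGraph n → (Fin n → Bool) → SimpleGraph n
bipartition G col .adj i j = adj G i j ∧ (col i xor col j)
bipartition G col .sym i j = cong₂ _∧_ (sym G i j) (xor-comm (col i) (col j))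
bipartition G col .loopless i = cong (_∧ _) (loopless G i)

bipartition-⊆ : ∀ {n} (G : SimpleGraph n) col → bipartition G col ⊆ᴳ G
bipartition-⊆ G col i j p with adj G i j
... | true = refl

bipartition-bipartite : ∀ {n} (G : SimpleGraph n) col → IsBipartite (bipartition G col)
bipartition-bipartite G col = col , bipartite
  where
  bipartite : ∀ i j → adj G i j ∧ (col i xor col j) ≡ true → col i ≡ col j → ⊥
  bipartite i j p same rewrite same | xor-same (col j) | ∧-zeroʳ (adj G i j) with () ← p

-- The double sum runs over ordered pairs and so counts each deleted edge twice; the final bound
-- absorbs this factor.
edgeCount-bipartition : ∀ {n} (G : SimpleGraph n) col →
  edgeCount G ≤ edgeCount (bipartition G col) + ∑ (λ x → ∑ (λ y → ⟦ adj G x y ∧ not (col x xor col y) ⟧))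
edgeCount-bipartition {n} G col = ∑-≤ {n} ∑! (∑! ⊕ ∑!) λ x → ∑-≤ {n} ∑! (∑! ⊕ ∑!) λ y →
  by-table 3 (λ l e b → ⟦ l ∧ e ⟧) (λ l e b → ⟦ l ∧ e ∧ b ⟧ + ⟦ e ∧ not b ⟧) tt
    (x <ꟳ y) (adj G x y) (col x xor col y)

-- With k = 2q the hypothesis becomes n < 5q, so n + 1 ≤ 5q, and doubling gains 2 where 2n < 5k
-- alone gives 1.
5k-parity : ∀ n {k} → 2 ∣ k → 2 * n < 5 * k → n + n + 2 ≤ k + k + k + k + k
5k-parity n (divides q refl) p = ≤-trans (≤-reflexive (eq n)) (≤-trans (*-monoʳ-≤ 2 n<5q) (≤-reflexive (eq' q)))
  where
  eq : ∀ n → n + n + 2 ≡ 2 * suc n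
  eq = solve-∀
  eq' : ∀ q → 2 * (5 * q) ≡ q * 2 + q * 2 + q * 2 + q * 2 + q * 2
  eq' = solve-∀
  eq'' : ∀ q → 5 * (q * 2) ≡ 2 * (5 * q)
  eq'' = solve-∀
  n<5q : n < 5 * q
  n<5q = *-cancelˡ-< 2 n (5 * q) (<-≤-trans p (≤-reflexive (eq'' q)))

theorem3p1 : (n k : ℕ) → 10 ^ 9 ≤ n → ¬ (2 ∣ n) → 2 ∣ k → 2 * n < 5 * k → 2 * k < n →
    (G : SimpleGraph n) → IsRegular G k →
    4 * triangleCount G + k * (n + 1) ≤ 3 * k * k →
    Σ (SimpleGraph n) (λ H → (H ⊆ᴳ G) × IsBipartite H ×
    ((2 * (edgeCount G ∸ edgeCount H)) ^ 2 ≤ 225 * k ^ 3))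
theorem3p1 n k 10⁹≤n _ 2∣k 2n<5k _ G reg few =
  bipartition G col , bipartition-⊆ G col , bipartition-bipartite G col , small
  where
  n≤3k : n ≤ 3 * k
  n≤3k = *-cancelˡ-≤ 2 (≤-trans (<⇒≤ 2n<5k) (linear k z≤n (eq k)))
    where
    eq : ∀ k → 5 * k + 0 + k ≡ 2 * (3 * k) + 0
    eq = solve-∀
  h m : ℕ
  h = 3 * k ∸ n
  m = h / 200
  n+h≡3k : n + h ≡ 3 * k
  n+h≡3k = m+[n∸m]≡n n≤3k
  3k≡n+h : k + k + k ≡ n + h
  3k≡n+h = trans (eq k) (≡.sym n+h≡3k)
    where
    eq : ∀ k → k + k + k ≡ 3 * k
    eq = solve-∀
  k≤2h : k ≤ h + h
  k≤2h = linear 0 (+-mono-≤ (<⇒≤ 2n<5k) (*-monoʳ-≤ 2 (≤-reflexive (≡.sym n+h≡3k)))) (eq n k h)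
    where
    eq : ∀ n k h → k + (5 * k + 2 * (n + h)) + 0 ≡ h + h + (2 * n + 2 * (3 * k))
    eq = solve-∀
  10⁷≤k : 10000000 ≤ k
  10⁷≤k = *-cancelˡ-≤ 5 (≤-trans (≤ᵇ⇒≤ 50000000 (2 * 10 ^ 9) tt) (≤-trans (*-monoʳ-≤ 2 10⁹≤n) (<⇒≤ 2n<5k)))
  40000≤h : 40000 ≤ h
  40000≤h = *-cancelˡ-≤ 2 (≤-trans (≤ᵇ⇒≤ 80000 10000000 tt) (≤-trans 10⁷≤k (≤-trans k≤2h (≤-reflexive (cong (h +_) (≡.sym (+-identityʳ h)))))))
  200m≤h : 200 * m ≤ h
  200m≤h = ≤-trans (≤-reflexive (*-comm 200 m)) (m/n*n≤m h 200)
  h≤200m+199 : h ≤ 199 + 200 * m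
  h≤200m+199 = ≤-trans (≤-reflexive (m≡m%n+[m/n]*n h 200)) (+-mono-≤ (≤-pred (m%n<n h 200)) (≤-reflexive (*-comm m 200)))
  -- This lets m absorb the remainder of h modulo 200.
  199≤m : 199 ≤ m
  199≤m = *-cancelˡ-≤ 200 (+-cancelˡ-≤ 199 _ _ (≤-trans (≤ᵇ⇒≤ (199 + 200 * 199) 40000 tt) (≤-trans 40000≤h h≤200m+199)))
  h≤201m : h ≤ 201 * m
  h≤201m = ≤-trans h≤200m+199 (+-monoˡ-≤ (200 * m) 199≤m)
  4T≤kh : 4 * triangleCount G ≤ k * h
  4T≤kh = linear k (+-mono-≤ few (*-monoʳ-≤ k (≤-reflexive (≡.sym n+h≡3k)))) (eq (triangleCount G) n k h)
    where
    eq : ∀ T n k h → 4 * T + (3 * k * k + k * (n + h)) + k ≡ k * h + (4 * T + k * (n + 1) + k * (3 * k))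
    eq = solve-∀
  open Colouring {m = m} G reg 3k≡n+h (5k-parity n 2∣k 2n<5k) k≤2h (≤-trans (s≤s z≤n) 199≤m) 200m≤h h≤201m
    (≤-trans (≤ᵇ⇒≤ 19296 40000 tt) 40000≤h) 4T≤kh
  col = proj₁ colouring
  deleted≤ : 2 * (edgeCount G ∸ edgeCount (bipartition G col)) ≤ 20000 * k
  deleted≤ = ≤-trans (*-monoʳ-≤ 2 (m≤n+o⇒m∸n≤o (edgeCount G) (edgeCount (bipartition G col)) {monochromatic col} (edgeCount-bipartition G col)))
    (monochromatic≤ col (proj₂ colouring))
  small : (2 * (edgeCount G ∸ edgeCount (bipartition G col))) ^ 2 ≤ 225 * k ^ 3
  -- (20000k)² = 4 · 10⁸ k², while k ≥ 10⁷ gives 225k³ ≥ 2.25 · 10⁹ k².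
  small = ≤-trans (^-monoˡ-≤ 2 deleted≤) (linear 0 (+-mono-≤ (*-monoʳ-≤ (225 * (k * k)) 10⁷≤k)
    (*-monoʳ-≤ (k * k) (≤ᵇ⇒≤ 400000000 2250000000 tt))) (eq k))
    where
    eq : ∀ k → 20000 * k * (20000 * k * 1) + (225 * (k * k) * k + k * k * 2250000000) + 0
      ≡ 225 * (k * (k * (k * 1))) + (225 * (k * k) * 10000000 + k * k * 400000000)
    eq = solve-∀
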